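{- If the genus function $g$ satisfies $g(n)\gg n/\log n$, then $\left(|\mathrm{Hered}(\mathcal F^g)_n|/n!\right)^{1/n}\to\infty$ as $n\to\infty$.
   Context: All graphs are finite and simple; $\mathcal B_n$ is the set of graphs in a class $\mathcal B$ on vertex set $[n]$. A genus function is $g:\mathbb N\to\mathbb N_0$. $\mathcal F^g$ is the class of graphs $G$ such that, if $G$ has $n$ vertices, every cellular embedding of $G$ has Euler genus at most $g(n)$; equivalently the cycle rank $e(G)-v(G)+\kappa(G)$ is at most $g(n)$ ($\kappa(G)$ = number of components). $\mathrm{Hered}(\mathcal B)$ is the class of graphs $G$ with $G[W]\in\mathcal B$ for every nonempty $W\subseteq V(G)$ (so for $G[W]$ the relevant bound is $g(|W|)$). $x\ll y$ means $x/y\to0$. -}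

module Defs where

open import Data.Bool using (Bool; true; false; T)
open import Data.Bool.Properties using (T?)
open import Data.Fin using (Fin; zero; suc; toℕ)
import Data.Fin as Fin
open import Data.Fin.Properties using (all?; toℕ-injective; toℕ<n)
import Data.Fin.Properties as Finₚ
open import Data.Fin.Subset using (Subset; inside; outside; ∣_∣; Nonempty)
open import Data.Fin.Subset.Properties using (anySubset?; nonempty?)
open import Data.Integer using (ℤ; +_)
import Data.Integer as ℤ
open import Data.List using (List; []; _∷_; length; filter; allFin; cartesianProduct; cartesianProductWith)
open import Data.List.Relation.Unary.Any using (Any; here; there)
import Data.List.Relation.Unary.Any.Properties as Anyₚ
import Data.List.Relation.Unary.All as All
import Data.List.Relation.Unary.AllPairs as AllPairs
import Data.List.Relation.Unary.Unique.Setoid as Uniqueₛ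
import Data.List.Relation.Unary.Unique.Setoid.Properties as Uniqueₛₚ
open import Data.Nat using (ℕ; zero; suc; _≤_; _<_; _*_; _^_; _!; s≤s⁻¹)
open import Data.Nat.Properties using (_≟_; ≤∧≢⇒<)
open import Data.Product using (_×_; _,_; ∃-syntax)
open import Data.Sum using (_⊎_; inj₁; inj₂)
open import Data.Vec using ([]; _∷_; lookup; tabulate)
open import Data.Vec.Properties using (lookup∘tabulate; tabulate∘lookup; tabulate-cong)
open import Relation.Binary using (Setoid)
open import Relation.Binary.Construct.Closure.ReflexiveTransitive using (Star; ε; _◅_; _◅◅_)
open import Relation.Binary.PropositionalEquality using (_≡_; refl; sym; trans; setoid)
open import Relation.Nullary using (Dec; yes; no; ¬?; _×-dec_; _⊎-dec_; _→-dec_)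
open import Relation.Nullary.Decidable using (map′; decidable-stable)

private
  variable
    n : ℕ

------------------------------------------------------------------------
-- Finite simple graphs on the vertex set Fin n

record Graph (n : ℕ) : Set where
  field
    adj      : Fin n → Fin n → Bool
    adj-sym  : ∀ i j → adj i j ≡ adj j i
    loopless : ∀ i → adj i i ≡ false

  Adjacent : Fin n → Fin n → Set
  Adjacent i j = T (adj i j)

  Connected : Fin n → Fin n → Set
  Connected = Star Adjacent

open Graph public

-- Equality of labelled graphs: the same edge set.
infix 4 _≈_
_≈_ : Graph n → Graph n → Set
G ≈ H = ∀ i j → adj G i j ≡ adj H i j

------------------------------------------------------------------------
-- Induced subgraphs

-- The increasing enumeration of the elements of W.
element : (W : Subset n) → Fin ∣ W ∣ → Fin n
element (inside  ∷ W) zero    = zero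
element (inside  ∷ W) (suc i) = suc (element W i)
element (outside ∷ W) i       = suc (element W i)

-- G [ W ] is relabelled by Fin ∣ W ∣ in an order-preserving way.
infix 8 _[_]
_[_] : Graph n → (W : Subset n) → Graph ∣ W ∣
G [ W ] = record
  { adj      = λ i j → adj G (element W i) (element W j)
  ; adj-sym  = λ i j → adj-sym G (element W i) (element W j)
  ; loopless = λ i → loopless G (element W i)
  }

------------------------------------------------------------------------
-- Connectedness is decidable (Floyd–Warshall)

private
  module _ (G : Graph n) where

    -- There is a walk from i to j with all intermediate vertices below k.
    Via : ℕ → Fin n → Fin n → Set
    Via zero    i j = i ≡ j ⊎ Adjacent G i j
    Via (suc k) i j = Via k i j ⊎ ∃[ m ] (toℕ m ≡ k × Via k i m × Via k m j)

    via? : ∀ k i j → Dec (Via k i j)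
    via? zero    i j = (i Finₚ.≟ j) ⊎-dec T? (adj G i j)
    via? (suc k) i j = via? k i j ⊎-dec
      Finₚ.any? (λ m → (toℕ m ≟ k) ×-dec (via? k i m ×-dec via? k m j))

    via-refl : ∀ k i → Via k i i
    via-refl zero    i = inj₁ refl
    via-refl (suc k) i = inj₁ (via-refl k i)

    via-adj : ∀ k {i j} → Adjacent G i j → Via k i j
    via-adj zero    a = inj₂ a
    via-adj (suc k) a = inj₁ (via-adj k a)

    via-sound : ∀ k {i j} → Via k i j → Connected G i j
    via-sound zero    (inj₁ refl)            = ε
    via-sound zero    (inj₂ a)               = a ◅ ε
    via-sound (suc k) (inj₁ p)               = via-sound k p
    via-sound (suc k) (inj₂ (_ , _ , p , q)) = via-sound k p ◅◅ via-sound k q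

    into : ∀ k {i m} → toℕ m ≡ k → Via (suc k) i m → Via k i m
    into k m≡k (inj₁ p) = p
    into k m≡k (inj₂ (l , l≡k , p , _))
      rewrite toℕ-injective (trans m≡k (sym l≡k)) = p

    outof : ∀ k {m j} → toℕ m ≡ k → Via (suc k) m j → Via k m j
    outof k m≡k (inj₁ p) = p
    outof k m≡k (inj₂ (l , l≡k , _ , q))
      rewrite toℕ-injective (trans m≡k (sym l≡k)) = q

    via-trans : ∀ k {i m j} → toℕ m < k → Via k i m → Via k m j → Via k i j
    via-trans (suc k) {m = m} m<1+k p q with toℕ m ≟ k
    ... | yes m≡k = inj₂ (m , m≡k , into k m≡k p , outof k m≡k q)
    ... | no  m≢k = go p q
      where
      m<k : toℕ m < k
      m<k = ≤∧≢⇒< (s≤s⁻¹ m<1+k) m≢k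

      go : ∀ {i j} → Via (suc k) i m → Via (suc k) m j → Via (suc k) i j
      go (inj₁ p) (inj₁ q) = inj₁ (via-trans k m<k p q)
      go (inj₁ p) (inj₂ (l , l≡k , q , r)) = inj₂ (l , l≡k , via-trans k m<k p q , r)
      go (inj₂ (l , l≡k , p , q)) (inj₁ r) = inj₂ (l , l≡k , p , via-trans k m<k q r)
      go (inj₂ (l , l≡k , p , _)) (inj₂ (l′ , l′≡k , _ , r))
        rewrite toℕ-injective (trans l≡k (sym l′≡k)) = inj₂ (l′ , l′≡k , p , r)

    via-complete : ∀ {i j} → Connected G i j → Via n i j
    via-complete ε       = via-refl n _
    via-complete (a ◅ w) = via-trans n (toℕ<n _) (via-adj n a) (via-complete w)

connected? : (G : Graph n) → ∀ i j → Dec (Connected G i j)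
connected? {n} G i j = map′ (via-sound G n) (via-complete G) (via? G n i j)

------------------------------------------------------------------------
-- Cycle rank

-- Each edge {i , j} is counted once, as the pair with i < j.
edgeCount : Graph n → ℕ
edgeCount {n} G = length (filter (λ (i , j) → (i Fin.<? j) ×-dec T? (adj G i j))
                                 (cartesianProduct (allFin n) (allFin n)))

-- Components are counted by their least vertices.
LeastInComponent : Graph n → Fin n → Set
LeastInComponent G i = ∀ j → Connected G i j → i Fin.≤ j

leastInComponent? : (G : Graph n) → ∀ i → Dec (LeastInComponent G i)
leastInComponent? G i = all? (λ j → connected? G i j →-dec (i Fin.≤? j))

componentCount : Graph n → ℕ
componentCount {n} G = length (filter (leastInComponent? G) (allFin n))

cycleRank : Graph n → ℤ
cycleRank {n} G = + edgeCount G ℤ.- + n ℤ.+ + componentCount G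

------------------------------------------------------------------------
-- Graph classes

GraphClass : Set₁
GraphClass = ∀ {n} → Graph n → Set

DecidableClass : GraphClass → Set
DecidableClass 𝓑 = ∀ {n} (G : Graph n) → Dec (𝓑 G)

-- The maximum Euler genus of a cellular embedding of G equals the cycle
-- rank of G, so "every cellular embedding of G has Euler genus at most
-- g(n)" reads as follows.  The value g 0 is never used by Hered.
𝓕 : (ℕ → ℕ) → GraphClass
𝓕 g {n} G = cycleRank G ℤ.≤ + g n

𝓕? : ∀ g → DecidableClass (𝓕 g)
𝓕? g {n} G = cycleRank G ℤ.≤? + g n

Hered : GraphClass → GraphClass
Hered 𝓑 G = ∀ W → Nonempty W → 𝓑 (G [ W ])

hered? : (𝓑 : GraphClass) → DecidableClass 𝓑 → DecidableClass (Hered 𝓑)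
hered? 𝓑 𝓑? G with anySubset? (λ W → nonempty? W ×-dec ¬? (𝓑? (G [ W ])))
... | yes (W , W≢∅ , ∉𝓑) = no λ h → ∉𝓑 (h W W≢∅)
... | no  none            = yes λ W W≢∅ →
  decidable-stable (𝓑? (G [ W ])) λ ∉𝓑 → none (W , W≢∅ , ∉𝓑)

------------------------------------------------------------------------
-- Counting labelled graphs

-- G with a new vertex zero whose neighbourhood is N.
addVertex : Graph n → Subset n → Graph (suc n)
addVertex {n} G N = record { adj = a ; adj-sym = a-sym ; loopless = a-irr }
  where
  a : Fin (suc n) → Fin (suc n) → Bool
  a zero    zero    = false
  a zero    (suc j) = lookup N j
  a (suc i) zero    = lookup N i
  a (suc i) (suc j) = adj G i j

  a-sym : ∀ i j → a i j ≡ a j i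
  a-sym zero    zero    = refl
  a-sym zero    (suc j) = refl
  a-sym (suc i) zero    = refl
  a-sym (suc i) (suc j) = adj-sym G i j

  a-irr : ∀ i → a i i ≡ false
  a-irr zero    = refl
  a-irr (suc i) = loopless G i

subsets : ∀ n → List (Subset n)
subsets zero    = [] ∷ []
subsets (suc n) = cartesianProductWith _∷_ (inside ∷ outside ∷ []) (subsets n)

graphs : ∀ n → List (Graph n)
graphs zero    = record { adj = λ () ; adj-sym = λ () ; loopless = λ () } ∷ []
graphs (suc n) = cartesianProductWith addVertex (graphs n) (subsets n)

-- ∣ 𝓑ₙ ∣
countClass : (𝓑 : GraphClass) → DecidableClass 𝓑 → ℕ → ℕ
countClass 𝓑 𝓑? n = length (filter 𝓑? (graphs n))

-- graphs n lists every labelled graph on Fin n exactly once up to _≈_.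

graphSetoid : ℕ → Setoid _ _
graphSetoid n = record
  { Carrier = Graph n
  ; _≈_ = _≈_
  ; isEquivalence = record
    { refl  = λ i j → refl
    ; sym   = λ p i j → sym (p i j)
    ; trans = λ p q i j → trans (p i j) (q i j)
    }
  }

subsets-complete : (W : Subset n) → Any (W ≡_) (subsets n)
subsets-complete [] = here refl
subsets-complete (s ∷ W) =
  Anyₚ.cartesianProductWith⁺ _∷_ (λ { refl refl → refl }) (side s) (subsets-complete W)
  where
  side : ∀ s → Any (s ≡_) (inside ∷ outside ∷ [])
  side inside  = here refl
  side outside = there (here refl)

subsets-unique : ∀ n → Uniqueₛ.Unique (setoid (Subset n)) (subsets n)
subsets-unique zero    = All.[] AllPairs.∷ AllPairs.[]
subsets-unique (suc n) =
  Uniqueₛₚ.cartesianProductWith⁺ (setoid Bool) (setoid (Subset n)) (setoid (Subset (suc n)))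
    _∷_ (λ { refl → refl , refl })
    (((λ ()) All.∷ All.[]) AllPairs.∷ (All.[] AllPairs.∷ AllPairs.[]))
    (subsets-unique n)

graphs-complete : (G : Graph n) → Any (G ≈_) (graphs n)
graphs-complete {zero}  G = here λ ()
graphs-complete {suc n} G =
  Anyₚ.cartesianProductWith⁺ addVertex pres (graphs-complete G⁻) (subsets-complete N)
  where
  G⁻ : Graph n
  G⁻ = record
    { adj      = λ i j → adj G (suc i) (suc j)
    ; adj-sym  = λ i j → adj-sym G (suc i) (suc j)
    ; loopless = λ i → loopless G (suc i)
    }

  N : Subset n
  N = tabulate (λ j → adj G zero (suc j))

  pres : ∀ {H M} → G⁻ ≈ H → N ≡ M → G ≈ addVertex H M
  pres p refl zero    zero    = loopless G zero
  pres p refl zero    (suc j) = sym (lookup∘tabulate _ j)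
  pres p refl (suc i) zero    = trans (adj-sym G (suc i) zero) (sym (lookup∘tabulate _ i))
  pres p refl (suc i) (suc j) = p i j

graphs-unique : ∀ n → Uniqueₛ.Unique (graphSetoid n) (graphs n)
graphs-unique zero    = All.[] AllPairs.∷ AllPairs.[]
graphs-unique (suc n) =
  Uniqueₛₚ.cartesianProductWith⁺ (graphSetoid n) (setoid (Subset n)) (graphSetoid (suc n))
    addVertex inj (graphs-unique n) (subsets-unique n)
  where
  inj : ∀ {G H : Graph n} {N M} → addVertex G N ≈ addVertex H M → G ≈ H × N ≡ M
  inj {N = N} {M} p = (λ i j → p (suc i) (suc j)) ,
    trans (sym (tabulate∘lookup N))
      (trans (tabulate-cong (λ j → p zero (suc j))) (tabulate∘lookup M))

------------------------------------------------------------------------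
-- Asymptotics

Eventually : (ℕ → Set) → Set
Eventually P = ∃[ n₀ ] (∀ n → n₀ ≤ n → P n)

-- g(n) ≫ n / log n:  for every C, eventually  C · (n / log₂ n) ≤ g(n),
-- i.e.  C · n ≤ g(n) · log₂ n,  exponentiated to base 2.  The base of the
-- logarithm only rescales C, and C ≥ 1 forces g(n) > 0 eventually.
_≫n/log-n : (ℕ → ℕ) → Set
g ≫n/log-n = ∀ C → Eventually λ n → 2 ^ (C * n) ≤ n ^ g n

-- (a(n) / n!)^{1/n} → ∞:  for every K, eventually  K ≤ (a(n) / n!)^{1/n},
-- i.e.  Kⁿ · n! ≤ a(n).
[_/n!]^1/n→∞ : (ℕ → ℕ) → Set
[ a /n!]^1/n→∞ = ∀ K → Eventually λ n → K ^ n * n ! ≤ a n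

{-# OPTIONS --safe #-}
-- Fix K.  With L of order log n, take M ≈ n / L disjoint chains of L vertices
-- and t ≈ M / 2 further vertices, and join both ends of every chain to
-- arbitrary ones of these t vertices.  If a vertex set W misses a vertex of a
-- chain, the rest of that chain contributes only trees hanging off; hence the
-- cycle rank of G[W] is at most the number of chains contained in W, that is
-- at most |W| / L, which is at most g(|W|).  Give the first vertices of the
-- chains fixed labels and arrange the other chain vertices arbitrarily: the
-- graph then determines the arrangement and the 2M attachments, so there are
-- (ML - M)! t^(2M) such graphs.  The fixed labels cost a factor n^(M + t) ≈
-- n^(3M/2) compared with n!, while t^(2M) ≥ n^(7M/4); the gain n^(M/4) exceeds
-- K^n for a suitable choice of L.
module Submission where

open import Defs
open import Data.Nat using (ℕ; zero; suc; _+_; _*_; _∸_; _^_; _!; _≤_; _<_; z≤n; s≤s; s≤s⁻¹; z<s; _/_; _%_; _≟_; _<?_; NonZero; >-nonZero)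
open import Data.Nat.DivMod using (m≡m%n+[m/n]*n; m%n<n; m*n/n≡m; /-monoˡ-≤)
open import Data.Nat.Properties hiding (_≟_; _<?_)
open import Data.Nat.Tactic.RingSolver using (solve-∀)
open import Data.Bool using (T)
open import Data.Bool.Properties using (T?)
open import Data.Fin as Fin using (Fin; zero; suc; toℕ; fromℕ; inject₁; _↑ˡ_; _↑ʳ_; splitAt; join; combine; remQuot; punchIn; funToFin; finToFun)
import Data.Fin.Properties as Finₚ
open import Data.Fin.Permutation as Perm using (Permutation′; _⟨$⟩ʳ_; _⟨$⟩ˡ_)
open import Data.Fin.Subset using (Subset; inside; outside; ∣_∣)
open import Data.Fin.Subset.Properties using (∣p∣≤n)
open import Data.Integer as ℤ using (+_; +≤+)
import Data.Integer.Properties as ℤₚ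
open import Data.List using (List; length; filter; allFin; lookup; cartesianProduct)
open import Data.List.Extrema ≤-totalOrder using (argmax; argmax-all; f[xs]≤f[argmax])
open import Data.List.Membership.Propositional.Properties using (∈-lookup; ∈-filter⁺; ∈-filter⁻; ∈-allFin)
import Data.List.Relation.Unary.All as All
import Data.List.Relation.Unary.All.Properties as Allₚ
open import Data.List.Relation.Unary.AllPairs using (_∷_)
open import Data.List.Relation.Unary.Any using (Any; index)
import Data.List.Relation.Unary.Any.Properties as Anyₚ
open import Data.List.Relation.Unary.Unique.Propositional using (Unique)
import Data.List.Relation.Unary.Unique.Propositional.Properties as Uniqueₚ
open import Data.Product using (_×_; _,_; ∃-syntax; proj₁; proj₂; uncurry)
open import Data.Sum using (_⊎_; inj₁; inj₂; [_,_]′; swap)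
open import Data.Sum.Properties using (inj₁-injective)
open import Data.Vec using (_∷_)
open import Function using (_∘_; Injective; _↔_; Injection; mk↣; mk⇔)
open import Function.Construct.Composition using (_↣-∘_)
open import Function.Properties.Inverse using (↔⇒↣; ↔-sym; ↔-refl)
open import Relation.Binary.Construct.Closure.ReflexiveTransitive using (ε; _◅_; _◅◅_; reverse)
open import Relation.Binary.Definitions using (DecidableEquality)
open import Relation.Binary.PropositionalEquality hiding ([_])
open import Relation.Nullary using (Dec; yes; no; does; ¬_; contradiction; _×-dec_; _⊎-dec_)
open import Relation.Nullary.Decidable using (map′; dec-true; dec-false; does-⇔)

-- Bounding the cycle rank by an orientation

lookup-injective : ∀ {A : Set} {xs : List A} → Unique xs → Injective _≡_ _≡_ (lookup xs)
lookup-injective (px ∷ u) {zero}  {zero}  eq = refl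
lookup-injective (px ∷ u) {zero}  {suc j} eq = contradiction eq (All.lookup px (∈-lookup j))
lookup-injective (px ∷ u) {suc i} {zero}  eq = contradiction (sym eq) (All.lookup px (∈-lookup i))
lookup-injective (px ∷ u) {suc i} {suc j} eq = cong suc (lookup-injective u eq)

injective⇒card≤ : ∀ {a b} {A B : Set} → Fin a ↔ A → Fin b ↔ B → {f : A → B} → Injective _≡_ _≡_ f → a ≤ b
injective⇒card≤ A↔ B↔ f-inj =
  Finₚ.injective⇒≤ (Injection.injective (↔⇒↣ (↔-sym B↔) ↣-∘ (mk↣ f-inj ↣-∘ ↔⇒↣ A↔)))

module _ {m} (H : Graph m) where

  connected-sym : ∀ {u v} → Connected H u v → Connected H v u
  connected-sym = reverse λ {u} {v} → subst T (adj-sym H u v)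

  module _ (φ : Fin m → ℕ) where

    summit : Fin m → Fin m
    summit u = argmax φ u (filter (connected? H u) (allFin m))

    summit-connected : ∀ u → Connected H u (summit u)
    summit-connected u = argmax-all φ ε (Allₚ.all-filter (connected? H u) (allFin m))

    summit-maximal : ∀ u {v} → Connected H u v → φ v ≤ φ (summit u)
    summit-maximal u {v} u~v =
      All.lookup (f[xs]≤f[argmax] u _) (∈-filter⁺ (connected? H u) (∈-allFin v) u~v)

    module _ {r} (Up : Fin m → Fin m → Set) (Extra : Fin r → Fin m → Fin m → Set) where

      -- An ascending edge is charged to its lower end.  A summit is the lower
      -- end of no edge, so it is free to pay for its component.
      data Charge (u v : Fin m) : Fin m ⊎ Fin r → Set where
        up     : Up u v → φ u < φ v → Charge u v (inj₁ u)
        down   : Up v u → φ v < φ u → Charge u v (inj₁ v)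
        extra  : ∀ {k} → Extra k u v → Charge u v (inj₂ k)
        extra′ : ∀ {k} → Extra k v u → Charge u v (inj₂ k)

      charge-climbs : ∀ {u v w} → Adjacent H u v → Charge u v (inj₁ w) →
                      ∃[ w′ ] (Adjacent H w w′ × φ w < φ w′)
      charge-climbs {v = v} a (up   _ lt) = v , a , lt
      charge-climbs {u} {v} a (down _ lt) = u , subst T (adj-sym H u v) a , lt

      module _ (Up-functional : ∀ {u v v′} → Up u v → Up u v′ → v ≡ v′)
               (Extra-functional : ∀ {k u v u′ v′} → Extra k u v → Extra k u′ v′ → u ≡ u′ × v ≡ v′)
               (charge : ∀ {u v} → Adjacent H u v → ∃[ s ] Charge u v s) where

        -- `Up` and `Extra` determine the unordered edge from its charge. The order `u < v` fixes
        -- the orientation, so the mixed cases, in which one pair would be the reverse of the other,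
        -- are impossible.
        charge-injective : ∀ {u v u′ v′ s} → u Fin.< v → u′ Fin.< v′ →
                           Charge u v s → Charge u′ v′ s → (u , v) ≡ (u′ , v′)
        charge-injective lt lt′ (up p _) (up q _) = cong (_ ,_) (Up-functional p q)
        charge-injective lt lt′ (up p _) (down q _) with refl ← Up-functional p q =
          contradiction lt′ (<-asym lt)
        charge-injective lt lt′ (down p _) (up q _) with refl ← Up-functional p q =
          contradiction lt′ (<-asym lt)
        charge-injective lt lt′ (down p _) (down q _) = cong (_, _) (Up-functional p q)
        charge-injective lt lt′ (extra p) (extra q) with refl , refl ← Extra-functional p q = refl
        charge-injective lt lt′ (extra p) (extra′ q) with refl , refl ← Extra-functional p q =
          contradiction lt′ (<-asym lt)
        charge-injective lt lt′ (extra′ p) (extra q) with refl , refl ← Extra-functional p q =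
          contradiction lt′ (<-asym lt)
        charge-injective lt lt′ (extra′ p) (extra′ q) with refl , refl ← Extra-functional p q = refl

        private
          edges = filter (λ (i , j) → (i Fin.<? j) ×-dec T? (adj H i j))
                         (cartesianProduct (allFin m) (allFin m))
          leasts = filter (leastInComponent? H) (allFin m)

          edge-proof : ∀ k → let (i , j) = lookup edges k in i Fin.< j × Adjacent H i j
          edge-proof k = proj₂ (∈-filter⁻ (λ (i , j) → (i Fin.<? j) ×-dec T? (adj H i j))
            {xs = cartesianProduct (allFin m) (allFin m)} (∈-lookup k))

          least-proof : ∀ k → LeastInComponent H (lookup leasts k)
          least-proof k = proj₂ (∈-filter⁻ (leastInComponent? H) {xs = allFin m} (∈-lookup k))

          -- Edges and components together are injected into vertices and extra edges: an edge goes
          -- to its charge, a component, given by its least vertex, to a summit.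
          target : Fin (length edges) ⊎ Fin (length leasts) → Fin m ⊎ Fin r
          target (inj₁ k) = proj₁ (charge (proj₂ (edge-proof k)))
          target (inj₂ k) = inj₁ (summit (lookup leasts k))

          charge-≢-summit : ∀ k l → target (inj₁ k) ≢ target (inj₂ l)
          charge-≢-summit k l eq
            with w , a , lt ← charge-climbs (proj₂ (edge-proof k))
                   (subst (Charge _ _) eq (proj₂ (charge (proj₂ (edge-proof k)))))
            = <⇒≱ lt (summit-maximal _ (summit-connected _ ◅◅ a ◅ ε))

          target-injective : Injective _≡_ _≡_ target
          target-injective {inj₁ k} {inj₁ l} eq = cong inj₁ (lookup-injective
            (Uniqueₚ.filter⁺ _ (Uniqueₚ.cartesianProduct⁺ (Uniqueₚ.allFin⁺ m) (Uniqueₚ.allFin⁺ m)))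
            (charge-injective (proj₁ (edge-proof k)) (proj₁ (edge-proof l))
              (subst (Charge _ _) eq (proj₂ (charge (proj₂ (edge-proof k)))))
              (proj₂ (charge (proj₂ (edge-proof l))))))
          target-injective {inj₁ k} {inj₂ l} eq = contradiction eq (charge-≢-summit k l)
          target-injective {inj₂ k} {inj₁ l} eq = contradiction (sym eq) (charge-≢-summit l k)
          -- A common summit puts both vertices in one component, and each is least there.
          target-injective {inj₂ k} {inj₂ l} eq = cong inj₂ (lookup-injective
            (Uniqueₚ.filter⁺ _ (Uniqueₚ.allFin⁺ m))
            (Finₚ.≤-antisym (least-proof k _ k~l) (least-proof l _ (connected-sym k~l))))
            where
            k~l : Connected H (lookup leasts k) (lookup leasts l)
            k~l = summit-connected _ ◅◅
              subst (λ w → Connected H w _) (sym (inj₁-injective eq)) (connected-sym (summit-connected _))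

        edges+components≤ : edgeCount H + componentCount H ≤ m + r
        edges+components≤ = injective⇒card≤ Finₚ.+↔⊎ Finₚ.+↔⊎ target-injective

        cycleRank≤ : cycleRank H ℤ.≤ + r
        cycleRank≤ = begin
          + e ℤ.- + m ℤ.+ + κ       ≡⟨ ℤₚ.+-assoc (+ e) (ℤ.- + m) (+ κ) ⟩
          + e ℤ.+ (ℤ.- + m ℤ.+ + κ) ≡⟨ cong (λ z → + e ℤ.+ z) (ℤₚ.+-comm (ℤ.- + m) (+ κ)) ⟩
          + e ℤ.+ (+ κ ℤ.- + m)     ≡⟨ ℤₚ.+-assoc (+ e) (+ κ) (ℤ.- + m) ⟨
          + (e + κ) ℤ.- + m         ≡⟨ ℤₚ.m-n≡m⊖n (e + κ) m ⟩
          (e + κ) ℤ.⊖ m             ≤⟨ ℤₚ.⊖-monoˡ-≤ m edges+components≤ ⟩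
          (m + r) ℤ.⊖ m             ≡⟨ ℤₚ.⊖-≥ (m≤m+n m r) ⟩
          + (m + r ∸ m)    ≡⟨ cong +_ (m+n∸m≡n m r) ⟩
          + r                       ∎
          where
          open ℤₚ.≤-Reasoning
          e = edgeCount H
          κ = componentCount H

-- Chains and their cycle rank

-- link j i is the i-th vertex (0 ≤ i ≤ ℓ) of the j-th chain; only such i occur.
data Position (t M : ℕ) : Set where
  node : Fin t → Position t M
  link : Fin M → ℕ → Position t M

module _ {t M : ℕ} where

  node-injective : ∀ {z z′} → node {t} {M} z ≡ node z′ → z ≡ z′
  node-injective refl = refl

  link-injective : ∀ {j j′ i i′} → link {t} {M} j i ≡ link j′ i′ → j ≡ j′ × i ≡ i′
  link-injective refl = refl , refl

  _≟ᴾ_ : DecidableEquality (Position t M)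
  node z ≟ᴾ node z′ = map′ (cong node) node-injective (z Finₚ.≟ z′)
  node _ ≟ᴾ link _ _ = no λ ()
  link _ _ ≟ᴾ node _ = no λ ()
  link j i ≟ᴾ link j′ i′ = map′ (λ { (refl , refl) → refl }) link-injective ((j Finₚ.≟ j′) ×-dec (i ≟ i′))

  module Chains (ℓ : ℕ) (x y : Fin M → Fin t) where

    data Arc : Position t M → Position t M → Set where
      first : ∀ j → Arc (link j 0) (node (x j))
      next  : ∀ j i → Arc (link j i) (link j (suc i))
      last  : ∀ j → Arc (link j ℓ) (node (y j))

    Edge : Position t M → Position t M → Set
    Edge p q = Arc p q ⊎ Arc q p

    arc? : ∀ p q → Dec (Arc p q)
    arc? (node _) _ = no λ ()
    arc? (link j i) (node z) = map′
      (λ { (inj₁ (refl , refl)) → first j ; (inj₂ (refl , refl)) → last j })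
      (λ { (first _) → inj₁ (refl , refl) ; (last _) → inj₂ (refl , refl) })
      (((i ≟ 0) ×-dec (z Finₚ.≟ x j)) ⊎-dec ((i ≟ ℓ) ×-dec (z Finₚ.≟ y j)))
    arc? (link j i) (link j′ i′) = map′
      (λ { (refl , refl) → next j i }) (λ { (next _ _) → refl , refl })
      ((j Finₚ.≟ j′) ×-dec (i′ ≟ suc i))

    edge? : ∀ p q → Dec (Edge p q)
    edge? p q = arc? p q ⊎-dec arc? q p

    previous : ℕ → Fin M → Position t M
    previous zero    j = node (x j)
    previous (suc i) j = link j i

    -- Chains are oriented away from a cut g: links below it towards the
    -- first vertex, the others towards the last.
    ascend : ∀ {i g} → Dec (i < g) → Dec (i ≡ ℓ) → Fin M → Position t M
    ascend {i} (yes _) _       j = previous i j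
    ascend     (no _)  (yes _) j = node (y j)
    ascend {i} (no _)  (no _)  j = link j (suc i)

    altitude : ∀ {i g} → Dec (i < g) → ℕ
    altitude {i} (yes _) = suc ℓ ∸ i
    altitude {i} (no _)  = i

    module _ (g : Fin M → ℕ) where

      parent : Position t M → Position t M
      -- A default: the strict inequality in `Ascent` keeps nodes from ascending.
      parent (node z)   = node z
      parent (link j i) = ascend (i <? g j) (i ≟ ℓ) j

      height : Position t M → ℕ
      -- A link that occurs has altitude at most `suc ℓ`, attained at index 0 below the cut, so
      -- nodes lie strictly above all of them.
      height (node _)   = suc (suc ℓ)
      height (link j i) = altitude (i <? g j)

      Ascent : Position t M → Position t M → Set
      Ascent p q = parent p ≡ q × height p < height q

      first-ascent : ∀ j → 0 < g j → Ascent (link j 0) (node (x j))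
      first-ascent j 0<g with 0 <? g j
      ... | yes _   = refl , ≤-refl
      ... | no  0≮g = contradiction 0<g 0≮g

      last-ascent : ∀ j → g j ≤ ℓ → Ascent (link j ℓ) (node (y j))
      last-ascent j g≤ℓ with ℓ <? g j | ℓ ≟ ℓ
      ... | yes ℓ<g | _ = contradiction ℓ<g (≤⇒≯ g≤ℓ)
      ... | no _ | yes _ = refl , m≤n⇒m≤1+n ≤-refl
      ... | no _ | no ℓ≢ℓ = contradiction refl ℓ≢ℓ

      next-descent : ∀ j i → suc i < g j → g j ≤ ℓ → Ascent (link j (suc i)) (link j i)
      next-descent j i 1+i<g g≤ℓ with suc i <? g j | i <? g j
      ... | no ≮g | _ = contradiction 1+i<g ≮g
      ... | yes _ | no ≮g = contradiction (<-trans (n<1+n i) 1+i<g) ≮g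
      ... | yes _ | yes _ = refl ,
        ≤-reflexive (sym (+-∸-assoc 1 (<⇒≤ (<-trans (n<1+n i) (<-≤-trans 1+i<g g≤ℓ)))))

      next-ascent : ∀ j i → g j ≤ i → i < ℓ → Ascent (link j i) (link j (suc i))
      next-ascent j i g≤i i<ℓ with i <? g j | i ≟ ℓ | suc i <? g j
      ... | yes i<g | _ | _ = contradiction i<g (≤⇒≯ g≤i)
      ... | no _ | yes i≡ℓ | _ = contradiction i<ℓ (<-irrefl i≡ℓ)
      ... | no _ | no _ | yes <g = contradiction (<-trans (n<1+n i) <g) (≤⇒≯ g≤i)
      ... | no _ | no _ | no _ = refl , ≤-refl

    module _ {m} (H : Graph m) (pos : Fin m → Position t M) (pos-injective : Injective _≡_ _≡_ pos)
             (pos-bounded : ∀ {u j i} → pos u ≡ link j i → i ≤ ℓ)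
             (edge : ∀ {u v} → Adjacent H u v → Edge (pos u) (pos v)) where

      Full : Fin M → Set
      Full j = ∀ (i : Fin (suc ℓ)) → ∃[ u ] pos u ≡ link j (toℕ i)

      occupied? : ∀ j (i : Fin (suc ℓ)) → Dec (∃[ u ] pos u ≡ link j (toℕ i))
      occupied? j i = Finₚ.any? λ u → pos u ≟ᴾ link j (toℕ i)

      full? : ∀ j → Dec (Full j)
      full? j = Finₚ.all? (occupied? j)

      -- A full chain is cut before its first vertex, so it ascends as a whole towards its last one
      -- and only its first arc is left over. Any other chain is cut at a missing vertex, where
      -- there is no edge to orient.
      data Cut (j : Fin M) : ℕ → Set where
        full : Full j → Cut j 0
        gap  : ∀ {g} → g ≤ ℓ → (∀ {u} → pos u ≢ link j g) → Cut j g

      cut : ∀ j → ∃[ g ] Cut j g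
      cut j with full? j
      ... | yes f = 0 , full f
      ... | no ¬f with i , free ← Finₚ.¬∀⟶∃¬ (suc ℓ) _ (occupied? j) ¬f =
        toℕ i , gap (Finₚ.toℕ≤pred[n] i) (λ eq → free (_ , eq))

      g : Fin M → ℕ
      g j = proj₁ (cut j)

      g≤ℓ : ∀ j → g j ≤ ℓ
      g≤ℓ j with cut j
      ... | _ , full _ = z≤n
      ... | _ , gap ≤ℓ _ = ≤ℓ

      -- No arc reaches the cut from below: `i < g j` excludes a full chain, whose cut is 0, and the
      -- vertex at a gap is missing.
      g-jump : ∀ {j i u} → i < g j → pos u ≡ link j (suc i) → suc i < g j
      g-jump {j} i<g eq with cut j
      ... | _ , gap _ free = ≤∧≢⇒< i<g λ { refl → free eq }

      g≡0⇒full : ∀ {j u} → ¬ 0 < g j → pos u ≡ link j 0 → Full j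
      g≡0⇒full {j} 0≮g eq with cut j
      ... | _ , full f = f
      ... | zero , gap _ free = contradiction eq free
      ... | suc _ , gap _ _ = contradiction z<s 0≮g

      fulls : List (Fin M)
      fulls = filter full? (allFin M)

      fulls-full : ∀ k → Full (lookup fulls k)
      fulls-full k = proj₂ (∈-filter⁻ full? {xs = allFin M} (∈-lookup k))

      fulls-index : ∀ {j} → Full j → ∃[ k ] j ≡ lookup fulls k
      fulls-index {j} f = index j∈ , Anyₚ.lookup-index j∈
        where j∈ = ∈-filter⁺ full? (∈-allFin j) f

      -- Full chains occupy disjoint sets of `suc ℓ` vertices, because `pos` reads chain and index
      -- off a vertex.
      fullCount*≤ : length fulls * suc ℓ ≤ m
      fullCount*≤ = injective⇒card≤ Finₚ.*↔× ↔-refl {f = λ (k , i) → proj₁ (fulls-full k i)} inj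
        where
        inj : Injective _≡_ _≡_ (λ (k , i) → proj₁ (fulls-full k i))
        inj {k , i} {k′ , i′} eq with j≡ , i≡ ← link-injective
          (trans (sym (proj₂ (fulls-full k i))) (trans (cong pos eq) (proj₂ (fulls-full k′ i′)))) =
          cong₂ _,_ (lookup-injective (Uniqueₚ.filter⁺ full? (Uniqueₚ.allFin⁺ M)) j≡) (Finₚ.toℕ-injective i≡)

      private
        Up : Fin m → Fin m → Set
        Up u v = parent g (pos u) ≡ pos v

        Extra : Fin (length fulls) → Fin m → Fin m → Set
        Extra k u v = pos u ≡ link (lookup fulls k) 0 × pos v ≡ node (x (lookup fulls k))

        φ : Fin m → ℕ
        φ u = height g (pos u)

        ascent : ∀ {u v p q} → pos u ≡ p → pos v ≡ q → Ascent g p q → Up u v × φ u < φ v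
        ascent refl refl a = a

        arc-charge : ∀ {u v p q} → pos u ≡ p → pos v ≡ q → Arc p q →
                     (Up u v × φ u < φ v) ⊎ (Up v u × φ v < φ u) ⊎ (∃[ k ] Extra k u v)
        arc-charge u≡ v≡ (first j) with 0 <? g j
        ... | yes 0<g = inj₁ (ascent u≡ v≡ (first-ascent g j 0<g))
        ... | no  0≮g with k , refl ← fulls-index (g≡0⇒full 0≮g u≡) = inj₂ (inj₂ (k , u≡ , v≡))
        arc-charge u≡ v≡ (next j i) with i <? g j
        ... | yes i<g = inj₂ (inj₁ (ascent v≡ u≡ (next-descent g j i (g-jump i<g v≡) (g≤ℓ j))))
        -- `pos-bounded` at `link j (suc i)` gives `i < ℓ`, so the link at `i` ascends to its
        -- successor and not to the end node.
        ... | no  i≮g = inj₁ (ascent u≡ v≡ (next-ascent g j i (≮⇒≥ i≮g) (pos-bounded v≡)))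
        arc-charge u≡ v≡ (last j) = inj₁ (ascent u≡ v≡ (last-ascent g j (g≤ℓ j)))

        charge : ∀ {u v} → Adjacent H u v → ∃[ s ] Charge H φ Up Extra u v s
        charge a with edge a
        ... | inj₁ arc with arc-charge refl refl arc
        ...   | inj₁ (p , lt)         = _ , up p lt
        ...   | inj₂ (inj₁ (p , lt))  = _ , down p lt
        ...   | inj₂ (inj₂ (_ , p))   = _ , extra p
        charge a | inj₂ arc with arc-charge refl refl arc
        ...   | inj₁ (p , lt)         = _ , down p lt
        ...   | inj₂ (inj₁ (p , lt))  = _ , up p lt
        ...   | inj₂ (inj₂ (_ , p))   = _ , extra′ p

      -- Every edge ascends to a parent, except the first arc of a full chain, which becomes an
      -- extra edge. The edges of `H` only have to be among those of the chains, so induced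
      -- subgraphs are covered.
      cycleRank≤fullCount : cycleRank H ℤ.≤ + length fulls
      cycleRank≤fullCount = cycleRank≤ H φ Up Extra
        (λ p q → pos-injective (trans (sym p) q))
        (λ (p , q) (p′ , q′) → pos-injective (trans p (sym p′)) , pos-injective (trans q (sym q′)))
        charge

-- Labelling and counting chain graphs

does-transfer : ∀ {A B : Set} (a? : Dec A) (b? : Dec B) → does a? ≡ does b? → A → B
does-transfer a? (yes b) eq a = b
does-transfer a? (no ¬b) eq a with () ← trans (sym (dec-true a? a)) eq

T-does : ∀ {A : Set} (a? : Dec A) → T (does a?) → A
T-does (yes a) _ = a

element-injective : ∀ {n} (W : Subset n) → Injective _≡_ _≡_ (element W)
element-injective (inside ∷ W)  {zero}  {zero}  _  = refl
element-injective (inside ∷ W)  {suc i} {suc j} eq = cong suc (element-injective W (Finₚ.suc-injective eq))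
element-injective (outside ∷ W) eq = element-injective W (Finₚ.suc-injective eq)

remQuot-injective : ∀ {n} k → Injective _≡_ _≡_ (remQuot {n} k)
remQuot-injective {n} k {c} {c′} eq =
  trans (sym (Finₚ.combine-remQuot {n} k c)) (trans (cong (uncurry combine) eq) (Finₚ.combine-remQuot {n} k c′))

funToFin-cong : ∀ {m n} {f f′ : Fin m → Fin n} → f ≗ f′ → funToFin f ≡ funToFin f′
funToFin-cong {zero}  eq = refl
funToFin-cong {suc m} eq = cong₂ combine (eq zero) (funToFin-cong (eq ∘ suc))

finToFun-injective : ∀ {m n} {c c′ : Fin (n ^ m)} → finToFun {n} {m} c ≗ finToFun c′ → c ≡ c′
finToFun-injective {m} {n} {c} {c′} eq =
  trans (sym (Finₚ.funToFin-finToFin {m} {n} c)) (trans (funToFin-cong eq) (Finₚ.funToFin-finToFin {m} {n} c′))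

-- A Lehmer code: the leading digit is the image of zero, the rest of the code arranges the other
-- points.
arrange : ∀ a → Fin (a !) → Permutation′ a
arrange zero    _ = Perm.id
arrange (suc a) c = let i , c′ = remQuot (a !) c in Perm.insert zero i (arrange a c′)

arrange-injective : ∀ a {c c′} → (∀ i → arrange a c ⟨$⟩ʳ i ≡ arrange a c′ ⟨$⟩ʳ i) → c ≡ c′
arrange-injective zero    {zero} {zero} _ = refl
arrange-injective (suc a) {c} {c′} eq = remQuot-injective (a !) (cong₂ _,_ (eq zero) (arrange-injective a rest))
  where
  i = proj₁ (remQuot {suc a} (a !) c)
  d = proj₂ (remQuot {suc a} (a !) c)
  i′ = proj₁ (remQuot {suc a} (a !) c′)
  d′ = proj₂ (remQuot {suc a} (a !) c′)
  rest : ∀ k → arrange a d ⟨$⟩ʳ k ≡ arrange a d′ ⟨$⟩ʳ k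
  rest k = Finₚ.punchIn-injective i _ _ (begin
    punchIn i (arrange a d ⟨$⟩ʳ k)               ≡⟨ Perm.insert-punchIn zero i (arrange a d) k ⟨
    arrange (suc a) c ⟨$⟩ʳ suc k                 ≡⟨ eq (suc k) ⟩
    arrange (suc a) c′ ⟨$⟩ʳ suc k                ≡⟨ Perm.insert-punchIn zero i′ (arrange a d′) k ⟩
    punchIn i′ (arrange a d′ ⟨$⟩ʳ k)             ≡⟨ cong (λ h → punchIn h (arrange a d′ ⟨$⟩ʳ k)) (eq zero) ⟨
    punchIn i (arrange a d′ ⟨$⟩ʳ k)              ∎)
    where open ≡-Reasoning

-- The list `graphs n` contains `f c` only up to `≈`, so `P` is required of every graph with the
-- same edges; `c` is sent to the index of a representative in the filtered list.
injective⇒≤count : ∀ {N n} {P : Graph n → Set} (P? : ∀ G → Dec (P G)) (f : Fin N → Graph n) →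
  (∀ {c c′} → f c ≈ f c′ → c ≡ c′) → (∀ c {H} → f c ≈ H → P H) → N ≤ length (filter P? (graphs n))
injective⇒≤count {n = n} {P} P? f f-inj f-P = Finₚ.injective⇒≤ {f = index ∘ hit} λ {c} {c′} eq →
  f-inj λ u v → trans (Anyₚ.lookup-index (hit c) u v)
    (trans (cong (λ k → adj (lookup (filter P? (graphs n)) k) u v) eq) (sym (Anyₚ.lookup-index (hit c′) u v)))
  where
  hit : ∀ c → Any (f c ≈_) (filter P? (graphs n))
  hit c with Anyₚ.filter⁺ P? (graphs-complete (f c))
  ... | inj₁ p = p
  ... | inj₂ ∉P = contradiction (f-P c (Anyₚ.lookup-result (graphs-complete (f c)))) ∉P

module Labelling (t M ℓ : ℕ) where

  -- Labels come in three blocks: nodes, first vertices of chains, other chain vertices. Only the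
  -- last block is permuted by `σ`.
  order : ℕ
  order = t + (M + M * ℓ)

  base : Fin t → Fin order
  base z = z ↑ˡ _

  module _ (σ : Permutation′ (M * ℓ)) where

    label : Fin M → Fin (suc ℓ) → Fin order
    label j zero    = t ↑ʳ (j ↑ˡ _)
    label j (suc i) = t ↑ʳ (M ↑ʳ (σ ⟨$⟩ʳ combine j i))

    place : Fin order → Position t M
    place v = [ node , (λ w → [ (λ j → link j 0) , inner ]′ (splitAt M w)) ]′ (splitAt t v)
      where
      inner : Fin (M * ℓ) → Position t M
      inner s = let j , i = remQuot ℓ (σ ⟨$⟩ˡ s) in link j (suc (toℕ i))

    place-base : ∀ z → place (base z) ≡ node z
    place-base z rewrite Finₚ.splitAt-↑ˡ t z (M + M * ℓ) = refl

    place-label : ∀ j i → place (label j i) ≡ link j (toℕ i)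
    place-label j zero
      rewrite Finₚ.splitAt-↑ʳ t (M + M * ℓ) (j ↑ˡ (M * ℓ)) | Finₚ.splitAt-↑ˡ M j (M * ℓ) = refl
    place-label j (suc i)
      rewrite Finₚ.splitAt-↑ʳ t (M + M * ℓ) (M ↑ʳ (σ ⟨$⟩ʳ combine j i))
            | Finₚ.splitAt-↑ʳ M (M * ℓ) (σ ⟨$⟩ʳ combine j i) =
      cong (λ (j , i) → link j (suc (toℕ i)))
        (trans (cong (remQuot ℓ) (Perm.inverseˡ σ)) (Finₚ.remQuot-combine j i))

    -- A view presenting each vertex as a `base` or a `label`, where `place` is known; injectivity
    -- and boundedness of `place` then follow by cases.
    data Covered : Fin order → Set where
      based    : ∀ z → Covered (base z)
      labelled : ∀ j i → Covered (label j i)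

    covered : ∀ v → Covered v
    covered v = subst Covered (Finₚ.join-splitAt t _ v) (outer (splitAt t v))
      where
      arranged : ∀ s → Covered (t ↑ʳ (M ↑ʳ s))
      arranged s = let j , i = remQuot {M} ℓ (σ ⟨$⟩ˡ s) in
        subst (λ s → Covered (t ↑ʳ (M ↑ʳ s)))
          (trans (cong (σ ⟨$⟩ʳ_) (Finₚ.combine-remQuot {M} ℓ (σ ⟨$⟩ˡ s))) (Perm.inverseʳ σ))
          (labelled j (suc i))

      chained : ∀ s → Covered (t ↑ʳ join M (M * ℓ) s)
      chained (inj₁ j) = labelled j zero
      chained (inj₂ s) = arranged s

      outer : ∀ s → Covered (join t (M + M * ℓ) s)
      outer (inj₁ z) = based z
      outer (inj₂ w) = subst (λ w → Covered (t ↑ʳ w)) (Finₚ.join-splitAt M _ w) (chained (splitAt M w))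

    place-injective : Injective _≡_ _≡_ place
    place-injective {u} {v} eq with covered u | covered v
    ... | based z | based z′ =
      cong base (node-injective (trans (sym (place-base z)) (trans eq (place-base z′))))
    ... | based z | labelled j i with () ← trans (sym (place-base z)) (trans eq (place-label j i))
    ... | labelled j i | based z with () ← trans (sym (place-base z)) (trans (sym eq) (place-label j i))
    ... | labelled j i | labelled j′ i′
      with refl , i≡ ← link-injective (trans (sym (place-label j i)) (trans eq (place-label j′ i′))) =
      cong (label j) (Finₚ.toℕ-injective i≡)

    place-bounded : ∀ {v j i} → place v ≡ link j i → i ≤ ℓ
    place-bounded {v} eq with covered v
    ... | based z with () ← trans (sym (place-base z)) eq
    ... | labelled j i with refl , refl ← link-injective (trans (sym (place-label j i)) eq) = Finₚ.toℕ≤pred[n] i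

    module _ (x y : Fin M → Fin t) where
      open Chains ℓ x y

      chainGraph : Graph order
      chainGraph = record
        { adj      = λ u v → does (edge? (place u) (place v))
        ; adj-sym  = λ u v → does-⇔ (mk⇔ swap swap) (edge? (place u) (place v)) (edge? (place v) (place u))
        ; loopless = λ u → dec-false (edge? (place u) (place u)) (irreflexive (place u))
        }
        where
        irreflexive : ∀ p → ¬ Edge p p
        irreflexive (node _)   (inj₁ ())
        irreflexive (node _)   (inj₂ ())
        irreflexive (link _ _) (inj₁ ())
        irreflexive (link _ _) (inj₂ ())

      -- The number of chains inside `W` bounds the cycle rank, and each takes `suc ℓ` vertices of
      -- `W`, so `sparse` applies. The claim concerns every `H` with the edges of `chainGraph`
      -- because counting meets only representatives.
      chainGraph∈Hered : ∀ {g} → (∀ m r → m ≤ order → r * suc ℓ ≤ m → r ≤ g m) →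
                         ∀ {H} → chainGraph ≈ H → Hered (𝓕 g) H
      chainGraph∈Hered sparse {H} G≈H W _ =
        ℤₚ.≤-trans (cycleRank≤fullCount (H [ W ]) pos pos-injective pos-bounded edge)
          (+≤+ (sparse _ _ (∣p∣≤n W) (fullCount*≤ (H [ W ]) pos pos-injective pos-bounded edge)))
        where
        pos : Fin ∣ W ∣ → Position t M
        pos = place ∘ element W
        pos-injective : Injective _≡_ _≡_ pos
        pos-injective = element-injective W ∘ place-injective
        pos-bounded : ∀ {u j i} → pos u ≡ link j i → i ≤ ℓ
        pos-bounded = place-bounded
        edge : ∀ {u v} → Adjacent (H [ W ]) u v → Edge (pos u) (pos v)
        edge {u} {v} a = T-does (edge? (pos u) (pos v)) (subst T (sym (G≈H (element W u) (element W v))) a)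

-- Recovering the arrangement and the attachments from the graph

module _ {t M l : ℕ} where
  -- With `ℓ` positive the two ends of a chain are different vertices, so the graph distinguishes
  -- `x` from `y`.
  private ℓ = suc l
  open Labelling t M ℓ
  open Chains {t} {M} ℓ

  module Decoding (σ σ′ : Permutation′ (M * ℓ)) (x y x′ y′ : Fin M → Fin t)
           (G≈G′ : chainGraph σ x y ≈ chainGraph σ′ x′ y′) where

    private
      transfer : ∀ u v {p q p′ q′} → place σ u ≡ p → place σ v ≡ q → place σ′ u ≡ p′ → place σ′ v ≡ q′ →
                 Edge x y p q → Edge x′ y′ p′ q′
      transfer u v refl refl refl refl =
        does-transfer (edge? x y _ _) (edge? x′ y′ _ _) (G≈G′ u v)

    -- The chain is traced from its first vertex, whose label is fixed: the next vertex is adjacent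
    -- to the current one and hence, under `σ′`, its neighbour on the same chain. The bound `k`
    -- makes the induction strong, since a step uses the two preceding vertices.
    label-unique : ∀ k j i → toℕ i ≤ k → label σ j i ≡ label σ′ j i
    label-unique k       j zero    _       = refl
    label-unique (suc k) j (suc i) (s≤s i≤k) = go (covered σ′ (label σ j (suc i))) refl
      where
      ih : ∀ i′ → toℕ i′ ≤ toℕ i → label σ j i′ ≡ label σ′ j i′
      ih i′ i′≤i = label-unique k j i′ (≤-trans i′≤i i≤k)

      i⁻ = inject₁ i
      toℕ-i⁻ : toℕ i⁻ ≡ toℕ i
      toℕ-i⁻ = Finₚ.toℕ-inject₁ i

      go : ∀ {u} → Covered σ′ u → label σ j (suc i) ≡ u → label σ j (suc i) ≡ label σ′ j (suc i)
      -- Labels of nodes do not depend on the arrangement, so a node under `σ′` is also one under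
      -- `σ`.
      go (based z) eq with () ← trans (sym (place-label σ j (suc i))) (trans (cong (place σ) eq) (place-base σ z))
      go (labelled j′ i′) eq
        with transfer (label σ j (suc i)) (label σ j i⁻)
               (place-label σ j (suc i)) (trans (place-label σ j i⁻) (cong (link j) toℕ-i⁻))
               (trans (cong (place σ′) eq) (place-label σ′ j′ i′))
               (trans (cong (place σ′) (ih i⁻ (≤-reflexive toℕ-i⁻)))
                 (trans (place-label σ′ j i⁻) (cong (link j) toℕ-i⁻)))
               (inj₂ (next j (toℕ i)))
      ... | edge = finish edge refl refl
        where
        -- The variables `a` and `b` stand for `toℕ i′` and `toℕ i` so that matching on the arc can
        -- unify its indices.
        finish : ∀ {a b} → Edge x′ y′ (link j′ a) (link j b) → a ≡ toℕ i′ → b ≡ toℕ i →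
                 label σ j (suc i) ≡ label σ′ j (suc i)
        finish (inj₂ (next _ _)) a≡ refl = trans eq (cong (label σ′ j) (Finₚ.toℕ-injective (sym a≡)))
        -- Otherwise the new vertex would be the one two steps back, which is already in use.
        finish (inj₁ (next _ _)) refl b≡
          with _ , i≡ ← link-injective (trans (sym (place-label σ j (suc i))) (trans (cong (place σ)
                 (trans eq (sym (ih i′ (≤-trans (n≤1+n _) (≤-reflexive b≡)))))) (place-label σ j i′))) =
          contradiction (trans (cong suc b≡) i≡) (>⇒≢ (m≤n⇒m≤1+n ≤-refl))

    labels-agree : ∀ j i → label σ j i ≡ label σ′ j i
    labels-agree j i = label-unique (toℕ i) j i ≤-refl

    arrangement-unique : ∀ s → σ ⟨$⟩ʳ s ≡ σ′ ⟨$⟩ʳ s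
    arrangement-unique s = subst (λ s → σ ⟨$⟩ʳ s ≡ σ′ ⟨$⟩ʳ s) (Finₚ.combine-remQuot {M} ℓ s)
      (Finₚ.↑ʳ-injective M _ _ (Finₚ.↑ʳ-injective t _ _ (labels-agree _ (suc _))))

    private
      attached : ∀ j i z → Edge x y (link j (toℕ i)) (node z) → Edge x′ y′ (link j (toℕ i)) (node z)
      attached j i z = transfer (label σ j i) (base z) (place-label σ j i) (place-base σ z)
        (trans (cong (place σ′) (labels-agree j i)) (place-label σ′ j i)) (place-base σ′ z)

    start-unique : x ≗ x′
    start-unique j = read refl (attached j zero (x j) (inj₁ (first j)))
      where
      read : ∀ {z} → z ≡ x j → Edge x′ y′ (link j 0) (node z) → x j ≡ x′ j
      read z≡ (inj₁ (first _)) = sym z≡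

    end-unique : y ≗ y′
    end-unique j = read refl (subst (λ i → Edge x′ y′ (link j i) (node (y j))) (Finₚ.toℕ-fromℕ ℓ)
      (attached j (fromℕ ℓ) (y j)
        (subst (λ i → Edge x y (link j i) (node (y j))) (sym (Finₚ.toℕ-fromℕ ℓ)) (inj₁ (last j)))))
      where
      read : ∀ {z} → z ≡ y j → Edge x′ y′ (link j ℓ) (node z) → y j ≡ y′ j
      read z≡ (inj₁ (last _)) = sym z≡

  chainGraphs≤Hered : ∀ {g} → (∀ m r → m ≤ order → r * suc ℓ ≤ m → r ≤ g m) →
    (M * ℓ) ! * (t ^ M * t ^ M) ≤ countClass (Hered (𝓕 g)) (hered? (𝓕 g) (𝓕? g)) order
  chainGraphs≤Hered {g} sparse =
    injective⇒≤count (hered? (𝓕 g) (𝓕? g)) encode encode-injective λ c {H} →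
      chainGraph∈Hered (σ c) (x c) (y c) {g} sparse {H}
    where
    Code = Fin ((M * ℓ) ! * (t ^ M * t ^ M))

    ends : Code → Fin (t ^ M) × Fin (t ^ M)
    ends c = remQuot (t ^ M) (proj₂ (remQuot {(M * ℓ) !} (t ^ M * t ^ M) c))

    σ : Code → Permutation′ (M * ℓ)
    σ c = arrange (M * ℓ) (proj₁ (remQuot (t ^ M * t ^ M) c))

    x y : Code → Fin M → Fin t
    x c = finToFun (proj₁ (ends c))
    y c = finToFun (proj₂ (ends c))

    encode : Code → Graph order
    encode c = chainGraph (σ c) (x c) (y c)

    encode-injective : ∀ {c c′} → encode c ≈ encode c′ → c ≡ c′
    encode-injective {c} {c′} eq = remQuot-injective _ (cong₂ _,_
      (arrange-injective (M * ℓ) arrangement-unique)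
      (remQuot-injective (t ^ M) (cong₂ _,_
        (finToFun-injective start-unique)
        (finToFun-injective end-unique))))
      where open Decoding (σ c) (σ c′) (x c) (y c) (x c′) (y c′) eq

-- Arithmetic

n<2^n : ∀ n → n < 2 ^ n
n<2^n zero    = s≤s z≤n
n<2^n (suc n) = begin
  suc (suc n)         ≤⟨ s≤s (n<2^n n) ⟩
  1 + 2 ^ n           ≤⟨ +-monoˡ-≤ (2 ^ n) (m^n>0 2 n) ⟩
  2 ^ n + 2 ^ n       ≡⟨ cong (λ s → 2 ^ n + s) (+-identityʳ (2 ^ n)) ⟨
  2 ^ suc n           ∎
  where open ≤-Reasoning

^-distribʳ-* : ∀ m n o → (m * n) ^ o ≡ m ^ o * n ^ o
^-distribʳ-* m n zero    = refl
^-distribʳ-* m n (suc o) = trans (cong (m * n *_) (^-distribʳ-* m n o)) (lemma m n (m ^ o) (n ^ o))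
  where
  lemma : ∀ a b c d → a * b * (c * d) ≡ a * c * (b * d)
  lemma = solve-∀

^-cancelʳ-≤ : ∀ m n o → 1 < m → m ^ n ≤ m ^ o → n ≤ o
^-cancelʳ-≤ m n o 1<m le = ≮⇒≥ λ o<n → <⇒≱ (^-monoʳ-< m 1<m o<n) le

^-cancelˡ-≤ : ∀ m n o .{{_ : NonZero o}} → m ^ o ≤ n ^ o → m ≤ n
^-cancelˡ-≤ m n o le = ≮⇒≥ λ n<m → <⇒≱ (^-monoˡ-< o n<m) le

-- The `m` largest factors of the factorial are each at most `m + n`.
[m+n]!≤ : ∀ m n → (m + n) ! ≤ n ! * (m + n) ^ m
[m+n]!≤ zero    n = ≤-reflexive (sym (*-identityʳ (n !)))
[m+n]!≤ (suc m) n = begin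
  s * (m + n) !             ≤⟨ *-monoʳ-≤ s ([m+n]!≤ m n) ⟩
  s * (n ! * (m + n) ^ m)   ≤⟨ *-monoʳ-≤ s (*-monoʳ-≤ (n !) (^-monoˡ-≤ m (n≤1+n (m + n)))) ⟩
  s * (n ! * s ^ m)         ≡⟨ lemma s (n !) (s ^ m) ⟩
  n ! * (s * s ^ m)         ∎
  where
  open ≤-Reasoning
  s = suc (m + n)
  lemma : ∀ a b c → a * (b * c) ≡ b * (a * c)
  lemma = solve-∀

log-bracket : ∀ N → 1 < N → ∀ n → ∃[ L ] (N ^ L ≤ suc n × suc n < N ^ suc L)
log-bracket N 1<N zero = 0 , ≤-refl , subst (1 <_) (sym (*-identityʳ N)) 1<N
log-bracket N 1<N (suc n) with L , ≤n , n< ← log-bracket N 1<N n | m≤n⇒m<n∨m≡n n<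
... | inj₁ 1+n< = L , m≤n⇒m≤1+n ≤n , 1+n<
... | inj₂ 1+n≡ = suc L , ≤-reflexive (sym 1+n≡) ,
  subst (_< N ^ suc (suc L)) (sym 1+n≡) (^-monoʳ-< N 1<N (n<1+n (suc L)))

4n≤2^2n : ∀ n .{{_ : NonZero n}} → 4 * n ≤ 2 ^ (2 * n)
4n≤2^2n (suc n) = begin
  4 * suc n         ≤⟨ *-monoʳ-≤ 4 (n<2^n n) ⟩
  4 * 2 ^ n         ≤⟨ *-monoʳ-≤ 4 (^-monoʳ-≤ 2 (m≤m+n n _)) ⟩
  4 * 2 ^ (2 * n)   ≡⟨ *-assoc 2 2 (2 ^ (2 * n)) ⟩
  2 ^ (2 + 2 * n)   ≡⟨ cong (2 ^_) (*-suc 2 n) ⟨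
  2 ^ (2 * suc n)   ∎
  where open ≤-Reasoning

-- M is the number of chains, of length L each, and t the number of further vertices;
-- 2t = M + ρ makes n^(t + M) about n^(3M/2).
module Parameters {k L n : ℕ} .{{_ : NonZero k}} .{{_ : NonZero L}} (large : 2 ^ (16 * k * L) ≤ n) where
  open ≤-Reasoning

  M t ρ : ℕ
  -- The wishes t + ML = n and 2t = M amount to M(2L + 1) = 2n; rounding down turns the second into
  -- 2t = M + ρ.
  M = 2 * n / suc (2 * L)
  ρ = 2 * n % suc (2 * L)
  t = n ∸ M * L

  2n≡ : 2 * n ≡ ρ + M * suc (2 * L)
  2n≡ = m≡m%n+[m/n]*n (2 * n) (suc (2 * L))

  ρ≤2L : ρ ≤ 2 * L
  ρ≤2L = s≤s⁻¹ (m%n<n (2 * n) (suc (2 * L)))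

  t+ML≡n : t + M * L ≡ n
  t+ML≡n = m∸n+n≡m {n} {M * L} (*-cancelˡ-≤ 2 (begin
    2 * (M * L)             ≤⟨ m≤n+m _ (ρ + M) ⟩
    ρ + M + 2 * (M * L)     ≡⟨ lemma ρ M L ⟩
    ρ + M * suc (2 * L)     ≡⟨ 2n≡ ⟨
    2 * n                   ∎))
    where
    lemma : ∀ r m l → r + m + 2 * (m * l) ≡ r + m * suc (2 * l)
    lemma = solve-∀

  2t≡M+ρ : 2 * t ≡ M + ρ
  2t≡M+ρ = +-cancelʳ-≡ (2 * (M * L)) (2 * t) (M + ρ) (begin-equality
    2 * t + 2 * (M * L)       ≡⟨ *-distribˡ-+ 2 t (M * L) ⟨
    2 * (t + M * L)           ≡⟨ cong (2 *_) t+ML≡n ⟩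
    2 * n                     ≡⟨ 2n≡ ⟩
    ρ + M * suc (2 * L)       ≡⟨ lemma ρ M L ⟩
    M + ρ + 2 * (M * L)       ∎)
    where
    lemma : ∀ r m l → r + m * suc (2 * l) ≡ m + r + 2 * (m * l)
    lemma = solve-∀

  -- `L` is at most logarithmic in `n`. The eighth power makes the factor `4 * L` lost in `n≤4Lt` at
  -- most n^(1/8).
  [4L]^8≤n : (4 * L) ^ 8 ≤ n
  [4L]^8≤n = begin
    (4 * L) ^ 8         ≤⟨ ^-monoˡ-≤ 8 (4n≤2^2n L) ⟩
    (2 ^ (2 * L)) ^ 8   ≡⟨ ^-*-assoc 2 (2 * L) 8 ⟩
    2 ^ (2 * L * 8)     ≤⟨ ^-monoʳ-≤ 2 (≤-trans (m≤m*n (2 * L * 8) k) (≤-reflexive (lemma k L))) ⟩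
    2 ^ (16 * k * L)    ≤⟨ large ⟩
    n                   ∎
    where
    lemma : ∀ k l → 2 * l * 8 * k ≡ 16 * k * l
    lemma = solve-∀

  instance
    4L≢0 : NonZero (4 * L)
    4L≢0 = m*n≢0 4 L

    n≢0 : NonZero n
    n≢0 = >-nonZero (≤-trans (m^n>0 2 (16 * k * L)) large)

  -- This controls the rounding: as ρ ≤ 2L, the term 8ρ costs at most 2M in `exponent`.
  8L≤M : 8 * L ≤ M
  8L≤M = subst (_≤ M) (m*n/n≡m (8 * L) (suc (2 * L))) (/-monoˡ-≤ (suc (2 * L)) (begin
    8 * L * suc (2 * L)            ≤⟨ *-monoʳ-≤ (8 * L) (+-monoˡ-≤ (2 * L) (m≤n*m 1 L)) ⟩
    8 * L * (L * 1 + 2 * L)        ≤⟨ *-monoʳ-≤ (8 * L) (≤-trans (m≤m+n _ L) (≤-reflexive (lemma₁ L))) ⟩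
    8 * L * (4 * L)                ≡⟨ lemma₂ L ⟩
    2 * (4 * L) ^ 2                ≤⟨ *-monoʳ-≤ 2 (^-monoʳ-≤ (4 * L) {2} {8} (s≤s (s≤s z≤n))) ⟩
    2 * (4 * L) ^ 8                ≤⟨ *-monoʳ-≤ 2 [4L]^8≤n ⟩
    2 * n                          ∎))
    where
    lemma₁ : ∀ l → l * 1 + 2 * l + l ≡ 4 * l
    lemma₁ = solve-∀
    lemma₂ : ∀ l → 8 * l * (4 * l) ≡ 2 * (4 * l * (4 * l * 1))
    lemma₂ = solve-∀

  n≤2ML : n ≤ 2 * (M * L)
  n≤2ML = *-cancelˡ-≤ 2 (begin
    2 * n                     ≡⟨ 2n≡ ⟩
    ρ + M * suc (2 * L)       ≤⟨ +-monoˡ-≤ _ (≤-trans ρ≤2L (≤-trans (*-monoˡ-≤ L {2} {8} (s≤s (s≤s z≤n))) 8L≤M)) ⟩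
    M + M * suc (2 * L)       ≡⟨ lemma₁ M L ⟩
    M * 2 + 2 * (M * L)       ≤⟨ +-monoˡ-≤ _ (*-monoʳ-≤ M (m≤m*n 2 L)) ⟩
    M * (2 * L) + 2 * (M * L) ≡⟨ lemma₂ M L ⟩
    2 * (2 * (M * L))         ∎)
    where
    lemma₁ : ∀ m l → m + m * suc (2 * l) ≡ m * 2 + 2 * (m * l)
    lemma₁ = solve-∀
    lemma₂ : ∀ m l → m * (2 * l) + 2 * (m * l) ≡ 2 * (2 * (m * l))
    lemma₂ = solve-∀

  -- `t` is at least n / 4L, and 4L is at most n^(1/8), so t ≥ n^(7/8).
  n^7≤t^8 : n ^ 7 ≤ t ^ 8
  n^7≤t^8 = *-cancelˡ-≤ n (begin
    n ^ 8                   ≤⟨ ^-monoˡ-≤ 8 n≤4Lt ⟩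
    (4 * L * t) ^ 8         ≡⟨ ^-distribʳ-* (4 * L) t 8 ⟩
    (4 * L) ^ 8 * t ^ 8     ≤⟨ *-monoˡ-≤ (t ^ 8) [4L]^8≤n ⟩
    n * t ^ 8               ∎)
    where
    lemma : ∀ t l → 2 * (2 * t * l) ≡ 4 * l * t
    lemma = solve-∀
    n≤4Lt : n ≤ 4 * L * t
    n≤4Lt = begin
      n                 ≤⟨ n≤2ML ⟩
      2 * (M * L)       ≤⟨ *-monoʳ-≤ 2 (*-monoˡ-≤ L (≤-trans (m≤m+n M ρ) (≤-reflexive (sym 2t≡M+ρ)))) ⟩
      2 * (2 * t * L)   ≡⟨ lemma t L ⟩
      4 * L * t         ∎

  -- The M-th power of `large` has exponent 16kLM on the left, which is at least 8kn by `n≤2ML`. In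
  -- effect K^n ≤ n^(M/8).
  K^8n≤n^M : ∀ {K} → K ≤ 2 ^ k → K ^ (8 * n) ≤ n ^ M
  K^8n≤n^M {K} K≤2^k = begin
    K ^ (8 * n)                ≤⟨ ^-monoˡ-≤ (8 * n) K≤2^k ⟩
    (2 ^ k) ^ (8 * n)          ≡⟨ ^-*-assoc 2 k (8 * n) ⟩
    2 ^ (k * (8 * n))          ≤⟨ ^-monoʳ-≤ 2 (*-monoʳ-≤ k (*-monoʳ-≤ 8 n≤2ML)) ⟩
    2 ^ (k * (8 * (2 * (M * L)))) ≡⟨ cong (2 ^_) (lemma k M L) ⟩
    2 ^ (16 * k * L * M)       ≡⟨ ^-*-assoc 2 (16 * k * L) M ⟨
    (2 ^ (16 * k * L)) ^ M     ≤⟨ ^-monoˡ-≤ M large ⟩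
    n ^ M                      ∎
    where
    lemma : ∀ k m l → k * (8 * (2 * (m * l))) ≡ 16 * k * l * m
    lemma = solve-∀

  -- Sixteenth powers clear the fractions: K^n costs n^(2M), the factor n^(t + M) costs n^(24M +
  -- 8ρ), and t^(2M) supplies n^(28M). The slack 2M absorbs 8ρ ≤ 16L.
  K^n*n^[t+M]≤t^2M : ∀ {K} → K ≤ 2 ^ k → K ^ n * n ^ (t + M) ≤ t ^ (M + M)
  K^n*n^[t+M]≤t^2M {K} K≤2^k = ^-cancelˡ-≤ _ _ 16 (begin
    (K ^ n * n ^ (t + M)) ^ 16              ≡⟨ ^-distribʳ-* (K ^ n) _ 16 ⟩
    (K ^ n) ^ 16 * (n ^ (t + M)) ^ 16       ≡⟨ cong₂ _*_ (^-*-assoc K n 16) (^-*-assoc n (t + M) 16) ⟩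
    K ^ (n * 16) * n ^ ((t + M) * 16)       ≡⟨ cong (λ e → K ^ e * n ^ ((t + M) * 16)) (lemma₁ n) ⟩
    K ^ (8 * n * 2) * n ^ ((t + M) * 16)    ≡⟨ cong (_* n ^ ((t + M) * 16)) (^-*-assoc K (8 * n) 2) ⟨
    (K ^ (8 * n)) ^ 2 * n ^ ((t + M) * 16)  ≤⟨ *-monoˡ-≤ _ (^-monoˡ-≤ 2 (K^8n≤n^M K≤2^k)) ⟩
    (n ^ M) ^ 2 * n ^ ((t + M) * 16)        ≡⟨ cong (_* n ^ ((t + M) * 16)) (^-*-assoc n M 2) ⟩
    n ^ (M * 2) * n ^ ((t + M) * 16)        ≡⟨ ^-distribˡ-+-* n (M * 2) _ ⟨
    n ^ (M * 2 + (t + M) * 16)              ≤⟨ ^-monoʳ-≤ n exponent ⟩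
    n ^ (7 * (4 * M))                       ≡⟨ ^-*-assoc n 7 (4 * M) ⟨
    (n ^ 7) ^ (4 * M)                       ≤⟨ ^-monoˡ-≤ (4 * M) n^7≤t^8 ⟩
    (t ^ 8) ^ (4 * M)                       ≡⟨ ^-*-assoc t 8 (4 * M) ⟩
    t ^ (8 * (4 * M))                       ≡⟨ cong (t ^_) (lemma₂ M) ⟩
    t ^ ((M + M) * 16)                      ≡⟨ ^-*-assoc t (M + M) 16 ⟨
    (t ^ (M + M)) ^ 16                      ∎)
    where
    lemma₁ : ∀ n → n * 16 ≡ 8 * n * 2
    lemma₁ = solve-∀
    lemma₂ : ∀ m → 8 * (4 * m) ≡ (m + m) * 16
    lemma₂ = solve-∀
    lemma₃ : ∀ m t → m * 2 + (t + m) * 16 ≡ 8 * (2 * t) + 18 * m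
    lemma₃ = solve-∀
    lemma₄ : ∀ m l → 8 * (m + 2 * l) + 18 * m ≡ 2 * (8 * l) + 26 * m
    lemma₄ = solve-∀
    lemma₅ : ∀ m → 2 * m + 26 * m ≡ 7 * (4 * m)
    lemma₅ = solve-∀
    exponent : M * 2 + (t + M) * 16 ≤ 7 * (4 * M)
    exponent = begin
      M * 2 + (t + M) * 16         ≡⟨ lemma₃ M t ⟩
      8 * (2 * t) + 18 * M         ≡⟨ cong (λ s → 8 * s + 18 * M) 2t≡M+ρ ⟩
      8 * (M + ρ) + 18 * M         ≤⟨ +-monoˡ-≤ (18 * M) (*-monoʳ-≤ 8 (+-monoʳ-≤ M ρ≤2L)) ⟩
      8 * (M + 2 * L) + 18 * M     ≡⟨ lemma₄ M L ⟩
      2 * (8 * L) + 26 * M         ≤⟨ +-monoˡ-≤ (26 * M) (*-monoʳ-≤ 2 8L≤M) ⟩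
      2 * M + 26 * M               ≡⟨ lemma₅ M ⟩
      7 * (4 * M)                  ∎

-- Since m ≤ n < 2^(16k(L + 1)) and L + 1 ≤ 2L, the binary logarithm of m is at most 32kL, so
-- density with constant 32k gives rL ≤ m ≤ g(m)L. For r > 0 also m ≥ L ≥ n₀, which puts m in the
-- range of `dense`; r = 0 is separate because m may then be small.
fullChains≤genus : ∀ {k L n n₀} {g : ℕ → ℕ} .{{_ : NonZero k}} .{{_ : NonZero L}} →
  (∀ m → n₀ ≤ m → 2 ^ (32 * k * m) ≤ m ^ g m) → n₀ ≤ L → n < (2 ^ (16 * k)) ^ suc L →
  ∀ m r → m ≤ n → r * L ≤ m → r ≤ g m
fullChains≤genus dense n₀≤L n< m zero    _   _ = z≤n
fullChains≤genus {k} {L} {n} {n₀} {g} dense n₀≤L n< m r@(suc _) m≤n rL≤m =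
  *-cancelʳ-≤ r (g m) L (≤-trans rL≤m (*-cancelˡ-≤ (32 * k) {{m*n≢0 32 k}}
    (^-cancelʳ-≤ 2 _ _ (s≤s (s≤s z≤n)) (begin
    2 ^ (32 * k * m)                    ≤⟨ dense m (≤-trans n₀≤L (≤-trans (m≤n*m L r) rL≤m)) ⟩
    m ^ g m                             ≤⟨ ^-monoˡ-≤ (g m) (≤-trans m≤n (<⇒≤ n<)) ⟩
    ((2 ^ (16 * k)) ^ suc L) ^ g m      ≡⟨ cong (_^ g m) (^-*-assoc 2 (16 * k) (suc L)) ⟩
    (2 ^ (16 * k * suc L)) ^ g m        ≡⟨ ^-*-assoc 2 (16 * k * suc L) (g m) ⟩
    2 ^ (16 * k * suc L * g m)          ≤⟨ ^-monoʳ-≤ 2 (*-monoˡ-≤ (g m) (*-monoʳ-≤ (16 * k) (+-monoˡ-≤ L (m≤n*m 1 L)))) ⟩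
    2 ^ (16 * k * (L * 1 + L) * g m)    ≡⟨ cong (2 ^_) (lemma k L (g m)) ⟩
    2 ^ (32 * k * (g m * L))            ∎))))
  where
  open ≤-Reasoning
  lemma : ∀ k l g → 16 * k * (l * 1 + l) * g ≡ 32 * k * (g * l)
  lemma = solve-∀

theorem5 : (g : ℕ → ℕ) → g ≫n/log-n →
    [ countClass (Hered (𝓕 g)) (hered? (𝓕 g) (𝓕? g)) /n!]^1/n→∞
theorem5 g g≫ K with n₀ , dense ← g≫ (32 * suc K) = N ^ (2 + n₀) , bound
  where
  k = suc K
  -- With this base, `N ^ L ≤ n` becomes the hypothesis `large`, and `n < N ^ suc L` is the one
  -- `fullChains≤genus` asks for.
  N = 2 ^ (16 * k)
  a = countClass (Hered (𝓕 g)) (hered? (𝓕 g) (𝓕? g))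

  1<N : 1 < N
  1<N = ^-monoʳ-< 2 (s≤s (s≤s z≤n)) {0} {16 * k} (s≤s z≤n)

  -- The threshold forces `2 + n₀ ≤ L`: the 2 makes `ℓ`, which is L - 1, positive, and `n₀ ≤ L` puts
  -- every vertex set containing a whole chain in the range of `dense`.
  bound : ∀ n → N ^ (2 + n₀) ≤ n → K ^ n * n ! ≤ a n
  bound zero    N^≤0 = contradiction N^≤0 (<⇒≱ (m^n>0 N {{m^n≢0 2 (16 * k)}} (2 + n₀)))
  bound (suc p) N^≤n with log-bracket N 1<N p
  ... | L , N^L≤n , n<N^1+L = split L N^L≤n n<N^1+L
          (≮⇒≥ λ L<  → <⇒≱ n<N^1+L (≤-trans (^-monoʳ-≤ N {{m^n≢0 2 (16 * k)}} L<) N^≤n))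
    where
    n = suc p

    split : ∀ L → N ^ L ≤ n → n < N ^ suc L → 2 + n₀ ≤ L → K ^ n * n ! ≤ a n
    split L@(suc ℓ@(suc l)) N^L≤n n<N^1+L (s≤s (s≤s n₀≤l)) = begin
      K ^ n * n !                             ≡⟨ cong (λ m → K ^ n * m !) n≡ ⟩
      K ^ n * (t + M + M * ℓ) !               ≤⟨ *-monoʳ-≤ (K ^ n) ([m+n]!≤ (t + M) (M * ℓ)) ⟩
      K ^ n * ((M * ℓ) ! * (t + M + M * ℓ) ^ (t + M))
                                              ≡⟨ cong (λ m → K ^ n * ((M * ℓ) ! * m ^ (t + M))) n≡ ⟨
      K ^ n * ((M * ℓ) ! * n ^ (t + M))       ≡⟨ swap-factors (K ^ n) ((M * ℓ) !) (n ^ (t + M)) ⟩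
      (M * ℓ) ! * (K ^ n * n ^ (t + M))       ≤⟨ *-monoʳ-≤ ((M * ℓ) !) (K^n*n^[t+M]≤t^2M K≤2^k) ⟩
      (M * ℓ) ! * t ^ (M + M)                 ≡⟨ cong ((M * ℓ) ! *_) (^-distribˡ-+-* t M M) ⟩
      (M * ℓ) ! * (t ^ M * t ^ M)             ≤⟨ chainGraphs≤Hered {t} {M} {l} {g} few-chains ⟩
      a (t + (M + M * ℓ))                     ≡⟨ cong a order≡ ⟨
      a n                                     ∎
      where
      open ≤-Reasoning
      open Parameters {k} {L} {n} (subst (_≤ n) (^-*-assoc 2 (16 * k) L) N^L≤n)

      order≡ : n ≡ t + (M + M * ℓ)
      order≡ = trans (sym t+ML≡n) (cong (λ s → t + s) (*-suc M ℓ))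

      n≡ : n ≡ t + M + M * ℓ
      n≡ = trans order≡ (sym (+-assoc t M (M * ℓ)))

      few-chains : ∀ m r → m ≤ t + (M + M * ℓ) → r * L ≤ m → r ≤ g m
      few-chains m r m≤ = fullChains≤genus {k} {L} {n} {n₀} {g} dense
        (m≤n⇒m≤1+n (m≤n⇒m≤1+n n₀≤l)) n<N^1+L m r (subst (m ≤_) (sym order≡) m≤)

      K≤2^k : K ≤ 2 ^ k
      K≤2^k = ≤-trans (n≤1+n K) (<⇒≤ (n<2^n k))

      swap-factors : ∀ a b c → a * (b * c) ≡ b * (a * c)
      swap-factors = solve-∀
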